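{- Let $n$ be a positive integer, let $B_n=G(2,n)$ be the group of signed permutations, and let $\varphi:B_n\to B_n$ be the bijection defined by the requirement that if $g$ corresponds to $[(P_0,P_1),(Q_0,Q_1)]$ under the Robinson–Schensted correspondence for $B_n$, then $\varphi(g)$ corresponds to $[(P_0,P_1'),(Q_0,Q_1')]$, where $T'$ denotes the transpose of the tableau $T$. Then for all $g\in B_n$: (a) $\mathrm{Neg}(g)=\mathrm{Neg}(\varphi(g))$; (b) $\mathrm{Des}_G(g)=\mathrm{Des}'_G(\varphi(g))$; (c) $\mathrm{Des}_G(g^{ -1})=\mathrm{Des}'_G(\varphi(g)^{ -1})$.
   Context: An element $g\in B_n$ is written $g=[g(1),\ldots,g(n)]$ with $g(i)\in\{\pm1,\ldots,\pm n\}$ and $|g(1)|,\ldots,|g(n)|$ a permutation of $1,\ldots,n$; it corresponds to the colored permutation $(c_1,\ldots,c_n;\sigma)$ with $\sigma(i)=|g(i)|$ and $c_i=1$ if $g(i)<0$, $c_i=0$ otherwise (so $-j$ stands for $j^1$). The product is composition of signed permutations. $\mathrm{Neg}(g)=\{i\in\{1,\ldots,n\}:c_i(g)=1\}$. Set $g(0)=0$. Two total orders on $\{ -n,\ldots,n\}$ are used: the color order $<$, given by $-1<-2<\cdots<-n<0<1<\cdots<n$, and the order $<'$, given by $-n<'\cdots<'-2<'-1<'0<'1<'\cdots<'n$. Then $\mathrm{Des}_G(g)=\{i\in\{0,\ldots,n-1\}:g(i)>g(i+1)\}$ and $\mathrm{Des}'_G(g)=\{i\in\{0,\ldots,n-1\}:g(i)>'g(i+1)\}$.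 Robinson–Schensted correspondence for $B_n$: $g\mapsto[(P_0,P_1),(Q_0,Q_1)]$, where for $\epsilon\in\{0,1\}$, $P_\epsilon$ is the tableau obtained by Schensted row insertion of the absolute values $|g(i)|$ of the entries with $c_i=\epsilon$, taken in increasing order of the positions $i$, and $Q_\epsilon$ is the corresponding recording tableau, filled with the positions $i$. This is a bijection from $B_n$ onto pairs of bitableaux $(P_0,P_1)$, $(Q_0,Q_1)$ such that $P_\epsilon,Q_\epsilon$ have the same shape, all tableaux have strictly increasing rows and columns, and the entries of $P_0$ and $P_1$ together (resp. of $Q_0$ and $Q_1$ together) are $1,\ldots,n$, each exactly once. -}

module Defs where

open import Algebra.Bundles using (Group)
open import Data.Bool.Base using (if_then_else_)
open import Data.Fin.Base using (Fin; zero; suc; toℕ; inject₁)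
open import Data.Fin.Permutation as Perm
  using (Permutation′; _⟨$⟩ʳ_; _⟨$⟩ˡ_; _∘ₚ_)
open import Data.Integer.Base as ℤ using (ℤ; +_; -[1+_]; +0; _◃_)
open import Data.List.Base
  using (List; []; _∷_; [_]; _∷ʳ_; map; foldl; foldr; filter; allFin; alignWith)
open import Data.Maybe.Base using (Maybe; just; nothing)
open import Data.Nat.Base as ℕ using (ℕ; zero; suc)
open import Data.Nat.Properties using (_<?_)
open import Data.Product.Base using (_×_; _,_; map₁)
open import Data.Sign.Base as Sign using (Sign)
import Data.Sign.Properties as Sign
import Data.These.Base as These
open import Function.Base using (id)
open import Level using (0ℓ)
open import Relation.Binary.Core using (Rel)
open import Relation.Binary.PropositionalEquality
  using (_≡_; refl; sym; trans; cong; cong₂)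
open import Relation.Nullary.Decidable.Core using (does)
open import Relation.Unary using (Pred)

private
  variable
    n : ℕ

-- The positions and absolute values 1, …, n are indexed by Fin n, the index i
-- standing for the number suc (toℕ i).  The sign of g at i is - exactly when
-- g(i) < 0, so Sign.+ is the colour 0 and Sign.- the colour 1.

record SignedPermutation (n : ℕ) : Set where
  field
    perm : Permutation′ n
    sign : Fin n → Sign

open SignedPermutation public

infix 4 _≈ˢ_

_≈ˢ_ : Rel (SignedPermutation n) 0ℓ
g ≈ˢ h = ∀ i → perm g ⟨$⟩ʳ i ≡ perm h ⟨$⟩ʳ i × sign g i ≡ sign h i

-- Composition of functions, h being applied first: as g(-j) = -g(j), the sign
-- of g(h(i)) is the product of the sign of h at i and that of g at |h(i)|.
-- (The library's _∘ₚ_ applies its left argument first.)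

infixl 7 _∘ˢ_

_∘ˢ_ : SignedPermutation n → SignedPermutation n → SignedPermutation n
g ∘ˢ h = record
  { perm = perm h ∘ₚ perm g
  ; sign = λ i → sign g (perm h ⟨$⟩ʳ i) Sign.* sign h i
  }

idˢ : SignedPermutation n
idˢ = record { perm = Perm.id ; sign = λ _ → Sign.+ }

inverseˢ : SignedPermutation n → SignedPermutation n
inverseˢ g = record
  { perm = Perm.flip (perm g)
  ; sign = λ j → sign g (perm g ⟨$⟩ˡ j)
  }

B : ℕ → Group 0ℓ 0ℓ
B n = record
  { Carrier = SignedPermutation n
  ; _≈_     = _≈ˢ_
  ; _∙_     = _∘ˢ_
  ; ε       = idˢ
  ; _⁻¹     = inverseˢ
  ; isGroup = record
    { isMonoid = record
      { isSemigroup = record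
        { isMagma = record
          { isEquivalence = record
            { refl  = λ _ → refl , refl
            ; sym   = λ p i → let (a , b) = p i in sym a , sym b
            ; trans = λ p q i → let (a , b) = p i ; (c , d) = q i
                                in trans a c , trans b d
            }
          ; ∙-cong = λ {g} {g′} {h} {h′} p q i →
              let (a , b) = q i ; (c , d) = p (perm h ⟨$⟩ʳ i) in
              trans c (cong (perm g′ ⟨$⟩ʳ_) a) ,
              cong₂ Sign._*_ (trans d (cong (sign g′) a)) b
          }
        ; assoc = λ f g h i → refl ,
            Sign.*-assoc (sign f (perm g ⟨$⟩ʳ (perm h ⟨$⟩ʳ i)))
                         (sign g (perm h ⟨$⟩ʳ i)) (sign h i)
        }
      ; identity = (λ g i → refl , Sign.*-identityˡ (sign g i))
                 , (λ g i → refl , Sign.*-identityʳ (sign g i))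
      }
    ; inverse = (λ g i → Perm.inverseˡ (perm g) ,
                  trans (cong (λ j → sign g j Sign.* sign g i)
                              (Perm.inverseˡ (perm g)))
                        (Sign.s*s≡+ (sign g i)))
              , (λ g i → Perm.inverseʳ (perm g) ,
                  Sign.s*s≡+ (sign g (perm g ⟨$⟩ˡ i)))
    ; ⁻¹-cong = λ {g} {h} p i →
        let e : perm g ⟨$⟩ˡ i ≡ perm h ⟨$⟩ˡ i
            e = trans
              (cong (perm g ⟨$⟩ˡ_)
                (trans (sym (Perm.inverseʳ (perm h)))
                       (sym (let (a , _) = p (perm h ⟨$⟩ˡ i) in a))))
              (Perm.inverseˡ (perm g))
            (_ , b) = p (perm g ⟨$⟩ˡ i)
        in e , trans b (cong (sign h) e)
    }
  }

Neg : SignedPermutation n → Pred (Fin n) 0ℓ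
Neg g i = sign g i ≡ Sign.-

∣_∣at_ : SignedPermutation n → Fin n → ℕ
∣ g ∣at i = suc (toℕ (perm g ⟨$⟩ʳ i))

-- The values g(0) = 0, g(1), …, g(n); here an index stands for itself.

_at_ : SignedPermutation n → Fin (suc n) → ℤ
g at zero    = +0
g at (suc i) = sign g i ◃ ∣ g ∣at i

-- The colour order -1 < -2 < ⋯ < -n < 0 < 1 < ⋯ < n.  The other order,
-- -n < ⋯ < -1 < 0 < 1 < ⋯ < n, is the usual order of ℤ.

infix 4 _<ᶜ_

data _<ᶜ_ : Rel ℤ 0ℓ where
  -<- : ∀ {j k} → j ℕ.< k → -[1+ j ] <ᶜ -[1+ k ]
  -<+ : ∀ {j k} → -[1+ j ] <ᶜ + k
  +<+ : ∀ {j k} → j ℕ.< k → + j <ᶜ + k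

-- In both descent sets i : Fin n stands for toℕ i ∈ {0, …, n-1}.

Des : SignedPermutation n → Pred (Fin n) 0ℓ
Des g i = g at (suc i) <ᶜ g at (inject₁ i)

Des′ : SignedPermutation n → Pred (Fin n) 0ℓ
Des′ g i = g at (suc i) ℤ.< g at (inject₁ i)

-- A tableau is the list of its (nonempty) rows, from the top.

Tableau : Set
Tableau = List (List ℕ)

-- The j-th column of r ∷ t is the j-th entry of r (if any) followed by the
-- j-th column of t (if any).

transpose : Tableau → Tableau
transpose = foldr (alignWith (These.fold [_] id _∷_)) []

-- Insertion of x into a row: x replaces the leftmost entry larger than x,
-- which is returned, or is put at the end if there is no such entry.

insertRow : ℕ → List ℕ → List ℕ × Maybe ℕ
insertRow x []       = [ x ] , nothing
insertRow x (y ∷ ys) =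
  if does (x <? y) then (x ∷ ys , just y)
                   else map₁ (y ∷_) (insertRow x ys)

-- Schensted row insertion, returning also the index (from 0) of the row in
-- which the shape has grown.

insert : ℕ → Tableau → Tableau × ℕ
insert x []      = [ [ x ] ] , 0
insert x (r ∷ t) with insertRow x r
... | r′ , nothing = r′ ∷ t , 0
... | r′ , just y  = let (t′ , k) = insert y t in r′ ∷ t′ , suc k

-- Puts i at the end of row k (from 0).  If that row does not exist, i forms a
-- new last row; this is only used with k at most the number of rows.

addAtRow : ℕ → ℕ → Tableau → Tableau
addAtRow i k       []      = [ [ i ] ]
addAtRow i zero    (r ∷ t) = (r ∷ʳ i) ∷ t
addAtRow i (suc k) (r ∷ t) = r ∷ addAtRow i k t

-- The insertion and recording tableaux of a list of pairs (label , value):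
-- the values are inserted from left to right, the labels recorded.

schenstedStep : Tableau × Tableau → ℕ × ℕ → Tableau × Tableau
schenstedStep (P , Q) (i , x) = let (P′ , k) = insert x P in P′ , addAtRow i k Q

schensted : List (ℕ × ℕ) → Tableau × Tableau
schensted = foldl schenstedStep ([] , [])

-- The pairs (i , |g(i)|) for the positions i at which g has sign s, in
-- increasing order of i.

subword : Sign → SignedPermutation n → List (ℕ × ℕ)
subword {n} s g =
  map (λ i → suc (toℕ i) , ∣ g ∣at i)
      (filter (λ i → sign g i Sign.≟ s) (allFin n))

Bitableau : Set
Bitableau = Tableau × Tableau

robinsonSchensted : SignedPermutation n → Bitableau × Bitableau
robinsonSchensted g =
  let (P₀ , Q₀) = schensted (subword Sign.+ g)
      (P₁ , Q₁) = schensted (subword Sign.- g)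
  in (P₀ , P₁) , (Q₀ , Q₁)

transposeSecond : Bitableau × Bitableau → Bitableau × Bitableau
transposeSecond ((P₀ , P₁) , (Q₀ , Q₁)) =
  (P₀ , transpose P₁) , (Q₀ , transpose Q₁)

{-# OPTIONS --safe #-}

-- For a word containing k and k + 1, the letter k + 1 precedes k exactly when it
-- lies in a strictly lower row of the insertion tableau: insertion never changes
-- which of the two is lower.  By the row bumping lemma, the value at place k + 1
-- is smaller than the one at place k exactly when the label k + 1 lies in a
-- strictly lower row of the recording tableau.  In a tableau with increasing rows
-- and columns k + 1 is either strictly below k or strictly to the right of it, so
-- transposition exchanges the two cases; on the negative letters the two orders
-- are opposite to each other, which compensates for the exchange.

module Submission where

open import Algebra.Bundles using (Group)
open import Data.Bool.Base using (true; false)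
open import Data.Empty using (⊥-elim)
open import Data.Fin.Base as Fin using (Fin; toℕ; inject₁)
open import Data.Fin.Permutation as Perm using (_⟨$⟩ˡ_)
open import Data.Fin.Properties using (toℕ-injective; toℕ-inject₁)
open import Data.Integer.Base as ℤ using (_◃_)
open import Data.List.Base
  using (List; []; _∷_; [_]; _∷ʳ_; _++_; map; concat; length; reverse;
         foldr; fromMaybe; allFin; alignWith)
open import Data.List.Membership.Propositional using (_∈_; _∉_)
open import Data.List.Membership.Propositional.Properties
  using (∈-concat⁺; ∈-concat⁻; ∈-++⁺ˡ; ∈-++⁻; ∈-map⁺; ∈-map⁻; ∈-allFin; ∈-filter⁺; ∈-filter⁻)
open import Data.List.Properties using (reverse-foldr; unfold-reverse; length-++)
open import Data.List.Relation.Binary.Permutation.Propositional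
  using (_↭_; refl; prep; swap; ↭-sym; ↭-trans; ↭⇒↭ₛ)
open import Data.List.Relation.Binary.Permutation.Propositional.Properties
  using (All-resp-↭; ∈-resp-↭; ↭-length; ∷↭∷ʳ; shift; ++⁺ˡ; ++⁺ʳ; ↭-reverse)
import Data.List.Relation.Binary.Permutation.Setoid.Properties as Permutation
open import Data.List.Relation.Binary.Pointwise using (Pointwise; []; _∷_)
open import Data.List.Relation.Binary.Prefix.Heterogeneous
  using (Prefix; []; _∷_; _++ᵖ_)
import Data.List.Relation.Binary.Prefix.Heterogeneous.Properties as Prefix
open import Data.List.Relation.Unary.All as All using (All; []; _∷_)
import Data.List.Relation.Unary.All.Properties as All
open import Data.List.Relation.Unary.AllPairs as AllPairs using (AllPairs; []; _∷_)
import Data.List.Relation.Unary.AllPairs.Properties as AllPairs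
open import Data.List.Relation.Unary.Any using (Any; here; there)
open import Data.List.Relation.Unary.Any.Properties using (reverse⁺; reverse⁻)
open import Data.List.Relation.Unary.Linked using (Linked; []; [-]; _∷_)
open import Data.List.Relation.Unary.Linked.Properties using (Linked⇒AllPairs)
open import Data.List.Relation.Unary.Unique.Propositional using (Unique)
open import Data.Maybe.Base using (Maybe; just; nothing)
open import Data.Nat.Base
  using (ℕ; zero; suc; _+_; _≤_; _<_; _>_; _<ᵇ_; z≤n; s≤s; s≤s⁻¹; s<s⁻¹; NonZero)
open import Data.Nat.Properties
open import Data.Product.Base using (∃; _×_; _,_; proj₁; proj₂)
open import Data.Sign.Base as Sign using (Sign)
import Data.Sign.Properties as Sign
open import Data.Sum.Base using (_⊎_; inj₁; inj₂)
import Data.These.Base as These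
open import Function.Base using (id; flip; _∘_)
open import Level using (0ℓ)
open import Relation.Binary.Core using (Rel)
open import Relation.Binary.PropositionalEquality
  using (_≡_; _≢_; refl; sym; trans; cong; subst; subst₂; setoid)
open import Relation.Nullary.Decidable.Core using (Dec)
open import Relation.Nullary.Negation using (¬_; contradiction)
open import Relation.Nullary.Reflects using (ofʸ; ofⁿ)
open import Relation.Unary using (Pred; _≐_)
open import Defs

private
  variable
    A : Set
    a b c d i j k m u v x y z : ℕ
    o : Maybe ℕ
    r r′ r″ s s′ : List ℕ
    t t′ P P′ Q T T′ T″ : Tableau
    w : List (ℕ × ℕ)

-- Tableaux

-- A version of `Any` with the position as a natural number in its type, so that rows and columns of
-- different tableaux can be compared with `≤` and `<`.
data At (P : Pred A 0ℓ) : List A → ℕ → Set where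
  here  : ∀ {x xs} → P x → At P (x ∷ xs) 0
  there : ∀ {x xs k} → At P xs k → At P (x ∷ xs) (suc k)

At⇒Any : ∀ {P : Pred A 0ℓ} {xs k} → At P xs k → Any P xs
At⇒Any (here p)  = here p
At⇒Any (there p) = there (At⇒Any p)

Any⇒At : ∀ {P : Pred A 0ℓ} {xs} → Any P xs → ∃ λ k → At P xs k
Any⇒At (here p)  = 0 , here p
Any⇒At (there p) = let (k , q) = Any⇒At p in suc k , there q

At-map : ∀ {P Q : Pred A 0ℓ} {xs k} → (∀ {x} → P x → Q x) → At P xs k → At Q xs k
At-map f (here p)  = here (f p)
At-map f (there p) = there (At-map f p)

InRow : ℕ → Tableau → ℕ → Set
InRow x = At (x ∈_)

Cell : ℕ → Tableau → ℕ → ℕ → Set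
Cell x T a c = At (λ r → At (x ≡_) r c) T a

InRow⇒∈ : InRow x T a → x ∈ concat T
InRow⇒∈ = ∈-concat⁺ ∘ At⇒Any

InRow⇒Cell : InRow x T a → ∃ λ c → Cell x T a c
InRow⇒Cell (here p)  = let (c , q) = Any⇒At p in c , here q
InRow⇒Cell (there p) = let (c , q) = InRow⇒Cell p in c , there q

∈⇒Cell : ∀ T → x ∈ concat T → ∃ λ a → ∃ λ c → Cell x T a c
∈⇒Cell T x∈T = let (a , p) = Any⇒At (∈-concat⁻ T x∈T) in a , InRow⇒Cell p

Cell⇒InRow : Cell x T a c → InRow x T a
Cell⇒InRow = At-map At⇒Any

Rows : Tableau → Set
Rows = All (AllPairs _<_)

-- One relation between neighbouring rows covers two conditions: a lower row is no longer than the
-- one above it, so the shape is a partition, and each of its entries exceeds the entry above.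
Columns : Tableau → Set
Columns = Linked (flip (Prefix _>_))

row-≤ : AllPairs _<_ r → At (x ≡_) r c → At (y ≡_) r d → c ≤ d → x ≤ y
row-≤ _       (here refl) (here refl) _   = ≤-refl
row-≤ (p ∷ _) (here refl) (there q)   _   = <⇒≤ (All.lookup p (At⇒Any q))
row-≤ (_ ∷ p) (there q)   (there q′)  c≤d = row-≤ p q q′ (s≤s⁻¹ c≤d)

row-< : AllPairs _<_ r → At (x ≡_) r c → At (y ≡_) r d → c < d → x < y
row-< (p ∷ _) (here refl) (there q)   _   = All.lookup p (At⇒Any q)
row-< (_ ∷ p) (there q)   (there q′)  c<d = row-< p q q′ (s<s⁻¹ c<d)

cell-≤ : Rows T → Cell x T a c → Cell y T a d → c ≤ d → x ≤ y
cell-≤ (p ∷ _) (here q)  (here q′)  = row-≤ p q q′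
cell-≤ (_ ∷ p) (there q) (there q′) = cell-≤ p q q′

cell-< : Rows T → Cell x T a c → Cell y T a d → c < d → x < y
cell-< (p ∷ _) (here q)  (here q′)  = row-< p q q′
cell-< (_ ∷ p) (there q) (there q′) = cell-< p q q′

-- `Prefix _>_` is transitive, so the comparison of neighbouring rows extends to any two rows.
above : Columns T → a < b → Cell y T b d → ∃ λ x → x < y × Cell x T a d
above cols = go (Linked⇒AllPairs (flip (Prefix.trans (flip <-trans))) cols)
  where
  entry : Prefix _>_ s r → At (y ≡_) s d → ∃ λ x → x < y × At (x ≡_) r d
  entry (p ∷ _) (here refl) = _ , p , here refl
  entry (_ ∷ p) (there q)   = let (x , x<y , q′) = entry p q in x , x<y , there q′

  lower : All (λ s → Prefix _>_ s r) t → Cell y t b d → ∃ λ x → x < y × At (x ≡_) r d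
  lower (p ∷ _)  (here q)  = entry p q
  lower (_ ∷ ps) (there q) = lower ps q

  go : AllPairs (flip (Prefix _>_)) T → a < b → Cell y T b d → ∃ λ x → x < y × Cell x T a d
  go {a = zero}  (p ∷ _) _   (there q) = let (x , x<y , q′) = lower p q in x , x<y , here q′
  go {a = suc _} (_ ∷ p) a<b (there q) =
    let (x , x<y , q′) = go p (s<s⁻¹ a<b) q in x , x<y , there q′

-- Both this and `Strict` quantify over all occurrences and hold vacuously as long as one of the two
-- letters is missing. This starts the induction along a word.
Weak : Tableau → ℕ → Set
Weak T k = ∀ {a b} → InRow k T a → InRow (suc k) T b → b ≤ a

Strict : Tableau → ℕ → Set
Strict T k = ∀ {a b} → InRow k T a → InRow (suc k) T b → a < b

-- Transposition

private
  consᵗ : These.These ℕ (List ℕ) → List ℕ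
  consᵗ = These.fold [_] id _∷_

alignWith-[]ʳ : ∀ r → alignWith consᵗ r [] ≡ map [_] r
alignWith-[]ʳ []      = refl
alignWith-[]ʳ (_ ∷ _) = refl

alignWith-head : ∀ r t → At (x ≡_) r c → InRow x (alignWith consᵗ r t) c
alignWith-head _       []      (here refl) = here (here refl)
alignWith-head (_ ∷ r) []      (there p)   =
  there (subst (λ t → InRow _ t _) (alignWith-[]ʳ r) (alignWith-head r [] p))
alignWith-head _       (_ ∷ _) (here refl) = here (here refl)
alignWith-head (_ ∷ r) (_ ∷ t) (there p)   = there (alignWith-head r t p)

alignWith-tail : ∀ r t → InRow x t c → InRow x (alignWith consᵗ r t) c
alignWith-tail []      _       (here p)  = here p
alignWith-tail []      (_ ∷ t) (there p) = there (alignWith-tail [] t p)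
alignWith-tail (_ ∷ _) _       (here p)  = here (there p)
alignWith-tail (_ ∷ r) (_ ∷ t) (there p) = there (alignWith-tail r t p)

transpose-InRow⁺ : Cell x T a c → InRow x (transpose T) c
transpose-InRow⁺ {T = r ∷ t} (here p)  = alignWith-head r (transpose t) p
transpose-InRow⁺ {T = r ∷ t} (there p) = alignWith-tail r (transpose t) (transpose-InRow⁺ p)

∈-transpose⁺ : ∀ T → x ∈ concat T → x ∈ concat (transpose T)
∈-transpose⁺ T p = let (_ , _ , q) = ∈⇒Cell T p in InRow⇒∈ (transpose-InRow⁺ q)

-- Otherwise `suc k` is weakly above and weakly to the left of `k`. The entry in the row of `suc k`
-- and the column of `k` is then at least `suc k` by its row and at most `k` by its column.
Weak-transpose : Rows T → Columns T → k ∈ concat T → suc k ∈ concat T →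
                 Weak T k → ¬ Weak (transpose T) k
Weak-transpose {T = T} rows cols k∈ sk∈ weak weakᵗ
  with a , c , p ← ∈⇒Cell T k∈ | b , d , q ← ∈⇒Cell T sk∈
  with weakᵗ (transpose-InRow⁺ p) (transpose-InRow⁺ q)
     | m≤n⇒m<n∨m≡n (weak (Cell⇒InRow p) (Cell⇒InRow q))
... | d≤c | inj₂ refl = 1+n≰n (cell-≤ rows q p d≤c)
... | d≤c | inj₁ b<a  =
  let (z , z<k , q′) = above cols b<a p
  in <-asym z<k (cell-≤ rows q q′ d≤c)

-- Otherwise `suc k` is strictly below and strictly to the right of `k`. The entry in the row of `k`
-- and the column of `suc k` would lie strictly between the two.
Strict-transpose : Rows T → Columns T → k ∈ concat T → suc k ∈ concat T →
                   Strict T k → ¬ Strict (transpose T) k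
Strict-transpose {T = T} rows cols k∈ sk∈ strict strictᵗ =
  let (a , c , p)     = ∈⇒Cell T k∈
      (b , d , q)     = ∈⇒Cell T sk∈
      a<b             = strict (Cell⇒InRow p) (Cell⇒InRow q)
      c<d             = strictᵗ (transpose-InRow⁺ p) (transpose-InRow⁺ q)
      (z , z<sk , q′) = above cols a<b q
  in <⇒≱ (cell-< rows p q′ c<d) (s≤s⁻¹ z<sk)

-- Row insertion

-- This and `Insertion` are the graphs of `insertRow` and `insert`; the later proofs are inductions
-- along the bumping path.
data RowInsertion (x : ℕ) : List ℕ → List ℕ → Maybe ℕ → Set where
  end  : RowInsertion x [] [ x ] nothing
  bump : x < y → RowInsertion x (y ∷ r) (x ∷ r) (just y)
  skip : y ≤ x → RowInsertion x r r′ o → RowInsertion x (y ∷ r) (y ∷ r′) o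

data Insertion (x : ℕ) : Tableau → Tableau → ℕ → Set where
  new    : Insertion x [] [ [ x ] ] 0
  append : RowInsertion x r r′ nothing → Insertion x (r ∷ t) (r′ ∷ t) 0
  bump   : RowInsertion x r r′ (just y) → Insertion y t t′ k →
           Insertion x (r ∷ t) (r′ ∷ t′) (suc k)

insertRow-view : ∀ x r → RowInsertion x r (proj₁ (insertRow x r)) (proj₂ (insertRow x r))
insertRow-view x [] = end
insertRow-view x (y ∷ r) with x <ᵇ y | <ᵇ-reflects-< x y
... | true  | ofʸ x<y = bump x<y
... | false | ofⁿ x≮y = skip (≮⇒≥ x≮y) (insertRow-view x r)

insert-view : ∀ x T → Insertion x T (proj₁ (insert x T)) (proj₂ (insert x T))
insert-view x [] = new
insert-view x (r ∷ t) with insertRow x r | insertRow-view x r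
... | _ , nothing | p = append p
... | _ , just y  | p = bump p (insert-view y t)

rowInsertion-↭ : RowInsertion x r r′ o → x ∷ r ↭ fromMaybe o ++ r′
rowInsertion-↭ end                        = refl
rowInsertion-↭ (bump _)                   = swap _ _ refl
rowInsertion-↭ {o = nothing} (skip y≤x p) = ↭-trans (swap _ _ refl) (prep _ (rowInsertion-↭ p))
rowInsertion-↭ {o = just _}  (skip y≤x p) =
  ↭-trans (swap _ _ refl) (↭-trans (prep _ (rowInsertion-↭ p)) (swap _ _ refl))

insertion-↭ : Insertion x T T′ k → x ∷ concat T ↭ concat T′
insertion-↭ new = refl
insertion-↭ (append {t = t} p) = ++⁺ʳ (concat t) (rowInsertion-↭ p)
insertion-↭ (bump {r′ = r′} {t = t} p q) =
  ↭-trans (++⁺ʳ (concat t) (rowInsertion-↭ p))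
    (↭-trans (↭-sym (shift _ r′ (concat t))) (++⁺ˡ r′ (insertion-↭ q)))

rowInsertion-∈⁻ : RowInsertion x r r′ o → z ∈ r′ → z ≡ x ⊎ z ∈ r
rowInsertion-∈⁻ {o = o} p z∈r′ with ∈-resp-↭ (↭-sym (rowInsertion-↭ p)) (∈-fromMaybe o z∈r′)
  where
  ∈-fromMaybe : ∀ o → z ∈ s → z ∈ fromMaybe o ++ s
  ∈-fromMaybe nothing  q = q
  ∈-fromMaybe (just _) q = there q
... | here eq = inj₁ eq
... | there q = inj₂ q

x<bumped : RowInsertion x r r′ (just y) → x < y
x<bumped (bump x<y) = x<y
x<bumped (skip _ p) = x<bumped p

bumped-∈ : RowInsertion x r r′ (just y) → y ∈ r
bumped-∈ (bump _)   = here refl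
bumped-∈ (skip _ p) = there (bumped-∈ p)

appended-max : RowInsertion x r r′ nothing → z ∈ r′ → z ≤ x
appended-max end          (here refl) = ≤-refl
appended-max (skip y≤x _) (here refl) = y≤x
appended-max (skip _ p)   (there q)   = appended-max p q

-- The bumped `y` is the least entry above `x` and has left the row, so nothing in the interval from
-- `x` (excluded) to `y` (included) remains.
bumped-split : AllPairs _<_ r → RowInsertion x r r′ (just y) → z ∈ r′ → z ≤ x ⊎ y < z
bumped-split _         (bump _)     (here refl) = inj₁ ≤-refl
bumped-split (y<r ∷ _) (bump _)     (there q)   = inj₂ (All.lookup y<r q)
bumped-split _         (skip y≤x _) (here refl) = inj₁ y≤x
bumped-split (_ ∷ inc) (skip _ p)   (there q)   = bumped-split inc p q

∈-inserted : RowInsertion x r r′ o → x ∈ r′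
∈-inserted end        = here refl
∈-inserted (bump _)   = here refl
∈-inserted (skip _ p) = there (∈-inserted p)

-- Preservation of the tableau conditions

All-fromMaybe⁻ : ∀ {P : Pred ℕ 0ℓ} o → All P (fromMaybe o ++ s) → All P s
All-fromMaybe⁻ o = All.++⁻ʳ (fromMaybe o)

rowInsertion-increasing : RowInsertion x r r′ o → All (x ≢_) r → AllPairs _<_ r → AllPairs _<_ r′
rowInsertion-increasing end _ _ = [] ∷ []
rowInsertion-increasing (bump x<y) _ (y<r ∷ inc) = All.map (<-trans x<y) y<r ∷ inc
rowInsertion-increasing {o = o} (skip y≤x p) (x≢y ∷ x∉r) (y<r ∷ inc) =
  All-fromMaybe⁻ o (All-resp-↭ (rowInsertion-↭ p) (≤∧≢⇒< y≤x (x≢y ∘ sym) ∷ y<r))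
  ∷ rowInsertion-increasing p x∉r inc

AllPairs-++⁻ʳ : ∀ {R : Rel A 0ℓ} xs {ys} → AllPairs R (xs ++ ys) → AllPairs R ys
AllPairs-++⁻ʳ []       p       = p
AllPairs-++⁻ʳ (_ ∷ xs) (_ ∷ p) = AllPairs-++⁻ʳ xs p

Unique-resp-↭ : ∀ {xs ys : List ℕ} → xs ↭ ys → Unique xs → Unique ys
Unique-resp-↭ p = Permutation.Unique-resp-↭ (setoid ℕ) (↭⇒↭ₛ p)

bumped-Unique : ∀ t → RowInsertion x r r′ (just y) →
                Unique (x ∷ concat (r ∷ t)) → Unique (y ∷ concat t)
bumped-Unique {r′ = r′} t p uniq
  with y∉ ∷ uniq′ ← Unique-resp-↭ (++⁺ʳ (concat t) (rowInsertion-↭ p)) uniq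
  = All.++⁻ʳ r′ y∉ ∷ AllPairs-++⁻ʳ r′ uniq′

insertion-Rows : Insertion x T T′ k → Unique (x ∷ concat T) → Rows T → Rows T′
insertion-Rows new _ _ = ([] ∷ []) ∷ []
insertion-Rows (append {r = r} p) (x∉ ∷ _) (inc ∷ rows) =
  rowInsertion-increasing p (All.++⁻ˡ r x∉) inc ∷ rows
insertion-Rows (bump {r = r} {t = t} p q) uniq@(x∉ ∷ _) (inc ∷ rows) =
  rowInsertion-increasing p (All.++⁻ˡ r x∉) inc ∷ insertion-Rows q (bumped-Unique t p uniq) rows

-- Insertion only lowers an entry or lengthens the row, so whatever fitted below it still fits.
rowInsertion-Prefix : RowInsertion x r r′ o → Prefix _>_ s r → Prefix _>_ s r′
rowInsertion-Prefix _          []        = []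
rowInsertion-Prefix (bump x<y) (q ∷ qs)  = <-trans x<y q ∷ qs
rowInsertion-Prefix (skip _ p) (q ∷ qs)  = q ∷ rowInsertion-Prefix p qs

-- The entry below the old place of `y` exceeds `y`, so `y` lands in that column or further left,
-- where the entry above it is now at most `x` and hence smaller than `y`.
bump-Prefix : RowInsertion x r r′ (just y) → RowInsertion y s s′ o →
              Prefix _>_ s r → Prefix _>_ s′ r′
bump-Prefix (bump x<y)   end          _        = x<y ∷ []
bump-Prefix (bump x<y)   (bump _)     (_ ∷ qs) = x<y ∷ qs
bump-Prefix (bump x<y)   (skip z≤y _) (y<z ∷ _) = contradiction z≤y (<⇒≱ y<z)
bump-Prefix (skip z≤x p) end          _        = ≤-<-trans z≤x (x<bumped p) ∷ []
bump-Prefix (skip z≤x p) (bump _)     (_ ∷ qs) =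
  ≤-<-trans z≤x (x<bumped p) ∷ rowInsertion-Prefix p qs
bump-Prefix (skip _ p)   (skip _ p′)  (q ∷ qs) = q ∷ bump-Prefix p p′ qs

insertion-Columns : Insertion x T T′ k → Columns T → Columns T′
insertion-Columns new _ = [-]
insertion-Columns (append p) [-] = [-]
insertion-Columns (append p) (q ∷ cols) = rowInsertion-Prefix p q ∷ cols
-- A new last row counts as an insertion into an empty row.
insertion-Columns (bump p new) [-] = bump-Prefix p end [] ∷ [-]
insertion-Columns (bump p p′@(append p₁)) (q ∷ cols) =
  bump-Prefix p p₁ q ∷ insertion-Columns p′ cols
insertion-Columns (bump p p′@(bump p₁ _)) (q ∷ cols) =
  bump-Prefix p p₁ q ∷ insertion-Columns p′ cols

-- Consecutive values in the insertion tableau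

insertion-∈⁻ : Insertion x T T′ k → z ∈ concat T′ → z ≡ x ⊎ z ∈ concat T
insertion-∈⁻ p q with ∈-resp-↭ (↭-sym (insertion-↭ p)) q
... | here eq = inj₁ eq
... | there r = inj₂ r

∈⇒InRow : ∀ T → x ∈ concat T → ∃ λ a → InRow x T a
∈⇒InRow T = Any⇒At ∘ ∈-concat⁻ T

-- The only danger is `j` in the top row with `suc j` below. It would require that `suc j` be bumped
-- past `j`, or that `j` arrive above a `suc j` already present. The freshness premise passes to the
-- next row: if `j` itself is bumped, `Weak` for the old tableau excludes `suc j` from the rows
-- below.
insertion-Weak : Insertion x T T′ k → Rows T → (x ≡ j → suc j ∉ concat T) →
                 Weak T j → Weak T′ j
insertion-Weak _ _ _ _ _ (here _) = z≤n
insertion-Weak (append p) _ fresh weak (here j∈r′) (there q) with rowInsertion-∈⁻ p j∈r′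
... | inj₁ refl = contradiction (InRow⇒∈ (there q)) (fresh refl)
... | inj₂ j∈r  = contradiction (weak (here j∈r) (there q)) λ ()
insertion-Weak (append p) _ _ weak (there q) (there q′) = weak (there q) (there q′)
insertion-Weak (bump {r = r} {t = t} p ins) (inc ∷ _) fresh weak (here j∈r′) (there q)
  with insertion-∈⁻ ins (InRow⇒∈ q)
... | inj₁ refl with bumped-split inc p j∈r′
...   | inj₂ sj<j = contradiction sj<j (<-asym (n<1+n _))
-- If `suc j` is bumped while `j` is in the new row, then `j ≤ x < suc j`, so it is `j` that was
-- inserted.
...   | inj₁ j≤x  =
  contradiction (∈-++⁺ˡ (bumped-∈ p)) (fresh (≤-antisym (s≤s⁻¹ (x<bumped p)) j≤x))
insertion-Weak (bump {t = t} p ins) _ fresh weak (here j∈r′) (there q) | inj₂ sj∈t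
  with (_ , q′) ← ∈⇒InRow t sj∈t | rowInsertion-∈⁻ p j∈r′
... | inj₁ refl = contradiction (InRow⇒∈ (there q′)) (fresh refl)
... | inj₂ j∈r  = contradiction (weak (here j∈r) (there q′)) λ ()
insertion-Weak {j = j} (bump {y = y} {t = t} p ins) (_ ∷ rows) _ weak (there q) (there q′) =
  s≤s (insertion-Weak ins rows fresh′ (λ u v → s≤s⁻¹ (weak (there u) (there v))) q q′)
  where
  fresh′ : y ≡ j → suc j ∉ concat t
  fresh′ refl sj∈t with () ← weak (here (bumped-∈ p)) (there (proj₂ (∈⇒InRow t sj∈t)))

-- The only danger is `suc j` in the top row. If it was there before, `j` can only be the inserted
-- value; but then it bumps `suc j`, as no value lies between them. A bumped `suc j` finds no `j`
-- further down, by `Strict` for the old tableau.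
insertion-Strict : Insertion x T T′ k → Rows T → (x ≡ suc j → j ∉ concat T) →
                   Strict T j → Strict T′ j
insertion-Strict new _ _ _ (here (here refl)) (here (here ()))
insertion-Strict (append p) _ _ _ (here _) (there _) = s≤s z≤n
insertion-Strict ins@(append p) _ fresh strict q (here sj∈r′)
  with rowInsertion-∈⁻ p sj∈r′ | insertion-∈⁻ ins (InRow⇒∈ q)
... | inj₁ refl | inj₁ ()
... | inj₁ refl | inj₂ j∈T  = contradiction j∈T (fresh refl)
... | inj₂ _    | inj₁ refl = contradiction (appended-max p sj∈r′) 1+n≰n
... | inj₂ sj∈r | inj₂ j∈T with () ← strict (proj₂ (∈⇒InRow (_ ∷ _) j∈T)) (here sj∈r)
insertion-Strict (append p) _ _ strict (there q) (there q′) = strict (there q) (there q′)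
insertion-Strict _ _ _ _ (here _) (there _) = s≤s z≤n
insertion-Strict ins′@(bump {t = t} p ins) (inc ∷ _) fresh strict q (here sj∈r′)
  with rowInsertion-∈⁻ p sj∈r′ | insertion-∈⁻ ins′ (InRow⇒∈ q)
... | inj₁ refl | inj₁ ()
... | inj₁ refl | inj₂ j∈T = contradiction j∈T (fresh refl)
... | inj₂ sj∈r | inj₂ j∈T with () ← strict (proj₂ (∈⇒InRow (_ ∷ _) j∈T)) (here sj∈r)
... | inj₂ sj∈r | inj₁ refl with bumped-split inc p sj∈r′
...   | inj₁ sj≤j = contradiction sj≤j 1+n≰n
...   | inj₂ y<sj = contradiction (x<bumped p) (≤⇒≯ (s≤s⁻¹ y<sj))
insertion-Strict {j = j} (bump {y = y} {t = t} p ins) (_ ∷ rows) _ strict (there q) (there q′) =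
  s≤s (insertion-Strict ins rows fresh′ (λ u v → s<s⁻¹ (strict (there u) (there v))) q q′)
  where
  fresh′ : y ≡ suc j → j ∉ concat t
  fresh′ refl j∈t with () ← strict (there (proj₂ (∈⇒InRow t j∈t))) (here (bumped-∈ p))

-- Row bumping

-- The inequality passes down the rows: what `y` bumps exceeds `x`, so by `bumped-split` it exceeds
-- what `x` bumped. Once the first path ends, its value is the maximum of its row and the second
-- path must end there too, if it has come so far.
bumping-< : Insertion x T T′ k → Insertion y T′ T″ m → Rows T → x < y → m ≤ k
bumping-< new          (append _)     _             _   = z≤n
bumping-< new          (bump p′ _)    _             x<y =
  contradiction (appended-max end (bumped-∈ p′)) (<⇒≱ (<-trans x<y (x<bumped p′)))
bumping-< (append _)   (append _)     _             _   = z≤n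
bumping-< (append p)   (bump p′ _)    _             x<y =
  contradiction (appended-max p (bumped-∈ p′)) (<⇒≱ (<-trans x<y (x<bumped p′)))
bumping-< (bump _ _)   (append _)     _             _   = z≤n
bumping-< (bump p ins) (bump p′ ins′) (inc ∷ rows)  x<y with bumped-split inc p (bumped-∈ p′)
... | inj₁ v≤x = contradiction v≤x (<⇒≱ (<-trans x<y (x<bumped p′)))
... | inj₂ u<v = s≤s (bumping-< ins ins′ rows u<v)

bumped-≤ : AllPairs _<_ r → RowInsertion x r r′ (just y) → z ∈ r → x < z → y ≤ z
bumped-≤ inc p z∈r x<z with ∈-resp-↭ (rowInsertion-↭ p) (there z∈r)
... | here refl = ≤-refl
... | there z∈r′ with bumped-split inc p z∈r′
...   | inj₁ z≤x = contradiction z≤x (<⇒≱ x<z)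
...   | inj₂ y<z = <⇒≤ y<z

appended-≥ : RowInsertion x r r′ nothing → z ∈ r → z ≤ x
appended-≥ p z∈r = appended-max p (∈-resp-↭ (rowInsertion-↭ p) (there z∈r))

-- In each row that the first path reaches, its value is still present and larger than the second
-- one, which must therefore bump something no larger than it. So the second path always goes on,
-- with the inequality preserved.
bumping-> : Insertion x T T′ k → Insertion y T′ T″ m → Rows T′ → y < x → k < m
bumping-> new          (append p′)    _            y<x =
  contradiction (appended-≥ p′ (here refl)) (<⇒≱ y<x)
bumping-> new          (bump _ _)     _            _   = s≤s z≤n
bumping-> (append p)   (append p′)    _            y<x =
  contradiction (appended-≥ p′ (∈-inserted p)) (<⇒≱ y<x)
bumping-> (append _)   (bump _ _)     _            _   = s≤s z≤n
bumping-> (bump p _)   (append p′)    _            y<x =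
  contradiction (appended-≥ p′ (∈-inserted p)) (<⇒≱ y<x)
bumping-> (bump p ins) (bump p′ ins′) (inc ∷ rows) y<x =
  s≤s (bumping-> ins ins′ rows (≤-<-trans (bumped-≤ inc p′ (∈-inserted p) y<x) (x<bumped p)))

-- Recording

SameShape : Rel Tableau 0ℓ
SameShape = Pointwise (λ r s → length r ≡ length s)

rowInsertion-length : RowInsertion x r r′ o → length (fromMaybe o) + length r′ ≡ suc (length r)
rowInsertion-length {r = r} {r′ = r′} {o = o} p =
  trans (sym (length-++ (fromMaybe o))) (sym (↭-length (rowInsertion-↭ p)))

length-∷ʳ : ∀ (r : List ℕ) i → length (r ∷ʳ i) ≡ suc (length r)
length-∷ʳ r i = trans (length-++ r) (+-comm (length r) 1)

addAtRow-SameShape : Insertion x P P′ k → SameShape P Q → SameShape P′ (addAtRow i k Q)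
addAtRow-SameShape new [] = refl ∷ []
addAtRow-SameShape (append p) (_∷_ {y = s} eq eqs) =
  trans (rowInsertion-length p) (trans (cong suc eq) (sym (length-∷ʳ s _))) ∷ eqs
addAtRow-SameShape (bump p ins) (eq ∷ eqs) =
  trans (suc-injective (rowInsertion-length p)) eq ∷ addAtRow-SameShape ins eqs

insertion-≤ : Insertion x P P′ k → SameShape P Q → k ≤ length Q
insertion-≤ new          _        = z≤n
insertion-≤ (append _)   _        = z≤n
insertion-≤ (bump _ ins) (_ ∷ eqs) = s≤s (insertion-≤ ins eqs)

addAtRow-↭ : ∀ i k Q → concat (addAtRow i k Q) ↭ i ∷ concat Q
addAtRow-↭ i k       []      = refl
addAtRow-↭ i zero    (r ∷ t) = ++⁺ʳ (concat t) (↭-sym (∷↭∷ʳ i r))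
addAtRow-↭ i (suc k) (r ∷ t) = ↭-trans (++⁺ˡ r (addAtRow-↭ i k t)) (shift i r (concat t))

-- The bound on `k` ensures that a newly formed row has index exactly `k`, since `addAtRow`
-- disregards `k` once the rows are exhausted.
addAtRow-InRow⁻ : ∀ Q → k ≤ length Q → InRow z (addAtRow i k Q) a →
                  InRow z Q a ⊎ (z ≡ i × a ≡ k)
addAtRow-InRow⁻ []      z≤n       (here (here refl)) = inj₂ (refl , refl)
addAtRow-InRow⁻ (r ∷ t) z≤n       (here p) with ∈-++⁻ r p
... | inj₁ q           = inj₁ (here q)
... | inj₂ (here refl) = inj₂ (refl , refl)
addAtRow-InRow⁻ (r ∷ t) z≤n       (there p) = inj₁ (there p)
addAtRow-InRow⁻ (r ∷ t) (s≤s k≤n) (here p)  = inj₁ (here p)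
addAtRow-InRow⁻ (r ∷ t) (s≤s k≤n) (there p) with addAtRow-InRow⁻ t k≤n p
... | inj₁ q             = inj₁ (there q)
... | inj₂ (refl , refl) = inj₂ (refl , refl)

addAtRow-Rows : ∀ k Q → All (_< i) (concat Q) → Rows Q → Rows (addAtRow i k Q)
addAtRow-Rows k       []      _   _            = ([] ∷ []) ∷ []
addAtRow-Rows zero    (r ∷ t) Q<i (inc ∷ rows) =
  AllPairs.++⁺ inc ([] ∷ []) (All.map (_∷ []) (All.++⁻ˡ r Q<i)) ∷ rows
addAtRow-Rows (suc k) (r ∷ t) Q<i (inc ∷ rows) =
  inc ∷ addAtRow-Rows k t (All.++⁻ʳ r Q<i) rows

∷ʳ-Prefix : All (_< i) r → length s < length r → Prefix _>_ s r → Prefix _>_ (s ∷ʳ i) r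
∷ʳ-Prefix {r = _ ∷ _} (r<i ∷ _)  _   []       = r<i ∷ []
∷ʳ-Prefix             (_ ∷ r<i)  s<r (q ∷ qs) = q ∷ ∷ʳ-Prefix r<i (s<s⁻¹ s<r) qs

-- Some entry must stand above the new label, which is the largest. The row lengths that guarantee
-- this are read off from `P′`, the insertion tableau of the same shape.
addAtRow-Columns : ∀ k Q → Columns P′ → SameShape P′ (addAtRow i k Q) →
                   All (_< i) (concat Q) → Columns Q → Columns (addAtRow i k Q)
addAtRow-Columns k       []      _ _ _ _ = [-]
addAtRow-Columns zero    (r ∷ _) _ _ _ [-] = [-]
addAtRow-Columns zero    (r ∷ _) _ _ _ (q ∷ cols) = (q ++ᵖ _) ∷ cols
addAtRow-Columns (suc k) (r ∷ []) (q ∷ _) (eq ∷ eq′ ∷ []) Q<i _ =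
  ∷ʳ-Prefix (All.++⁻ˡ r Q<i) (subst₂ _≤_ eq′ eq (Prefix.length-mono q)) [] ∷ [-]
addAtRow-Columns (suc zero) (r ∷ t@(s ∷ _)) (q ∷ cols) (eq ∷ eqs@(eq′ ∷ _)) Q<i (q′ ∷ cols′) =
  ∷ʳ-Prefix (All.++⁻ˡ r Q<i)
            (subst₂ _≤_ (trans eq′ (length-∷ʳ s _)) eq (Prefix.length-mono q)) q′
  ∷ addAtRow-Columns zero t cols eqs (All.++⁻ʳ r Q<i) cols′
addAtRow-Columns (suc (suc k)) (r ∷ t@(_ ∷ _)) (_ ∷ cols) (_ ∷ eqs@(_ ∷ _)) Q<i (q′ ∷ cols′) =
  q′ ∷ addAtRow-Columns (suc k) t cols eqs (All.++⁻ʳ r Q<i) cols′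

-- The Schensted correspondence for words, which are listed from their last letter.

data Run : List (ℕ × ℕ) → Tableau → Tableau → Set where
  []  : Run [] [] []
  _∷_ : Insertion x P P′ k → Run w P Q → Run ((i , x) ∷ w) P′ (addAtRow i k Q)

schensted-run : ∀ w → Run (reverse w) (proj₁ (schensted w)) (proj₂ (schensted w))
schensted-run w =
  subst (λ s → Run (reverse w) (proj₁ s) (proj₂ s))
    (reverse-foldr (flip schenstedStep) _ w) (go (reverse w))
  where
  go : ∀ w → let s = foldr (flip schenstedStep) ([] , []) w in Run w (proj₁ s) (proj₂ s)
  go []            = []
  go ((_ , x) ∷ w) = insert-view x _ ∷ go w

Later : Rel (ℕ × ℕ) 0ℓ
Later (i , x) (j , y) = j < i × x ≢ y

run-values : Run w P Q → concat P ↭ map proj₂ w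
run-values []          = refl
run-values (ins ∷ run) = ↭-trans (↭-sym (insertion-↭ ins)) (prep _ (run-values run))

run-labels : Run w P Q → concat Q ↭ map proj₁ w
run-labels []                                = refl
run-labels (_∷_ {k = k} {Q = Q} {i = i} _ run) =
  ↭-trans (addAtRow-↭ i k Q) (prep i (run-labels run))

fresh-value : Run w P Q → All (Later (i , x)) w → All (x ≢_) (concat P)
fresh-value run later =
  All-resp-↭ (↭-sym (run-values run)) (All.map⁺ (All.map proj₂ later))

fresh-label : Run w P Q → All (Later (i , x)) w → All (_< i) (concat Q)
fresh-label run later =
  All-resp-↭ (↭-sym (run-labels run)) (All.map⁺ (All.map proj₁ later))

run-Unique : Run w P Q → AllPairs Later w → Unique (concat P)
run-Unique run later =
  Unique-resp-↭ (↭-sym (run-values run)) (AllPairs.map⁺ (AllPairs.map proj₂ later))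

run-Rows : AllPairs Later w → Run w P Q → Rows P
run-Rows _              []          = []
run-Rows (later ∷ valid) (ins ∷ run) =
  insertion-Rows ins (fresh-value run later ∷ run-Unique run valid) (run-Rows valid run)

run-Columns : Run w P Q → Columns P
run-Columns []          = []
run-Columns (ins ∷ run) = insertion-Columns ins (run-Columns run)

run-SameShape : Run w P Q → SameShape P Q
run-SameShape []          = []
run-SameShape (ins ∷ run) = addAtRow-SameShape ins (run-SameShape run)

recording-Rows : AllPairs Later w → Run w P Q → Rows Q
recording-Rows _               []                          = []
recording-Rows (later ∷ valid) (_∷_ {k = k} {Q = Q} _ run) =
  addAtRow-Rows k Q (fresh-label run later) (recording-Rows valid run)

recording-Columns : AllPairs Later w → Run w P Q → Columns Q
recording-Columns _               []                                    = []
recording-Columns (later ∷ valid) run@(_∷_ {k = k} {Q = Q} ins run′) =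
  addAtRow-Columns k Q (run-Columns run) (run-SameShape run)
    (fresh-label run′ later) (recording-Columns valid run′)

-- Descents of a word read off from its tableaux

Descents : Tableau → ℕ → ℕ → ℕ → Set
Descents T k u v = (u < v → Weak T k) × (v < u → Strict T k)

-- Here `u` and `v` are the labels of two consecutive values. Just before the later of the two
-- letters is inserted the relevant predicate is vacuous, and every insertion from then on preserves
-- it; the distinctness of the values supplies the freshness premises.
insertion-descents : AllPairs Later w → Run w P Q →
                     (u , j) ∈ w → (v , suc j) ∈ w → Descents P j u v
insertion-descents (later ∷ valid) (ins ∷ run) (there p) (there q) =
  let rows            = run-Rows valid run
      (weak , strict) = insertion-descents valid run p q
  in (λ u<v → insertion-Weak ins rows
                (λ eq → contradiction eq (proj₂ (All.lookup later p))) (weak u<v))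
   , (λ v<u → insertion-Strict ins rows
                (λ eq → contradiction eq (proj₂ (All.lookup later q))) (strict v<u))
insertion-descents (later ∷ valid) (ins ∷ run) (there p) (here refl) =
  (λ _ → insertion-Weak ins (run-Rows valid run) (λ ())
           (λ _ r → contradiction refl (All.lookup (fresh-value run later) (InRow⇒∈ r))))
  , λ v<u → contradiction v<u (<-asym (proj₁ (All.lookup later p)))
insertion-descents (later ∷ valid) (ins ∷ run) (here refl) (there q) =
  (λ u<v → contradiction u<v (<-asym (proj₁ (All.lookup later q))))
  , λ _ → insertion-Strict ins (run-Rows valid run) (λ ())
            (λ r _ → contradiction refl (All.lookup (fresh-value run later) (InRow⇒∈ r)))

∉-label : All (_< i) (concat Q) → i ≤ z → ¬ InRow z Q a
∉-label Q<i i≤z p = <⇒≱ (All.lookup Q<i (InRow⇒∈ p)) i≤z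

-- Here `x` and `y` are the values at two consecutive labels. Labels increase along the word, so
-- these letters are inserted one right after the other and the row bumping lemma compares their
-- rows; larger labels added afterwards move neither.
recording-descents : AllPairs Later w → Run w P Q →
                     (j , x) ∈ w → (suc j , y) ∈ w → Descents Q j x y
recording-descents (later ∷ valid) (_∷_ {k = k} {w = w} {Q = Q} {i = i} ins run)
                   (there p) (there q) =
  let (weak , strict) = recording-descents valid run p q
  in (λ x<y p′ q′ → weak x<y (old p p′) (old q q′))
   , (λ y<x p′ q′ → strict y<x (old p p′) (old q q′))
  where
  old : (z , u) ∈ w → InRow z (addAtRow i k Q) a → InRow z Q a
  old z∈w p with addAtRow-InRow⁻ Q (insertion-≤ ins (run-SameShape run)) p
  ... | inj₁ q          = q
  ... | inj₂ (eq , _) = contradiction eq (<⇒≢ (proj₁ (All.lookup later z∈w)))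
recording-descents {j = j} (later ∷ later′ ∷ valid)
                   (_∷_ {k = k′} ins′ run@(_∷_ {k = k} {Q = Q} ins run′))
                   (there (here refl)) (here refl) =
    (λ x<y p q → subst₂ _≤_ (sym (row-suc q)) (sym (row p))
                 (bumping-< ins ins′ (run-Rows valid run′) x<y))
  , (λ y<x p q → subst₂ _<_ (sym (row p)) (sym (row-suc q))
                 (bumping-> ins ins′ (run-Rows (later′ ∷ valid) run) y<x))
  where
  Q′ = addAtRow j k Q

  row-suc : InRow (suc j) (addAtRow (suc j) k′ Q′) a → a ≡ k′
  row-suc p with addAtRow-InRow⁻ Q′ (insertion-≤ ins′ (run-SameShape run)) p
  ... | inj₁ q        = ⊥-elim (∉-label (fresh-label run later) ≤-refl q)
  ... | inj₂ (_ , eq) = eq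

  row : InRow j (addAtRow (suc j) k′ Q′) a → a ≡ k
  row p with addAtRow-InRow⁻ Q′ (insertion-≤ ins′ (run-SameShape run)) p
  ... | inj₁ q with addAtRow-InRow⁻ Q (insertion-≤ ins (run-SameShape run′)) q
  ...   | inj₁ q′       = ⊥-elim (∉-label (fresh-label run′ later′) ≤-refl q′)
  ...   | inj₂ (_ , eq) = eq
-- A letter inserted between the two would have a label strictly between `j` and `suc j`.
recording-descents (((i<sj , _) ∷ _) ∷ later ∷ _) (_ ∷ _ ∷ _) (there (there p)) (here refl) =
  contradiction (proj₁ (All.lookup later p)) (≤⇒≯ (s≤s⁻¹ i<sj))
recording-descents (later ∷ _) (_ ∷ _) (here refl) (there q) =
  contradiction (proj₁ (All.lookup later q)) (<-asym (n<1+n _))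

Standard : Tableau → Set
Standard T = Rows T × Columns T

<-from-≯ : x ≢ y → ¬ y < x → x < y
<-from-≯ x≢y y≮x = ≤∧≢⇒< (≮⇒≥ y≮x) x≢y

module _ {T} (k∈T : k ∈ concat T) (sk∈T : suc k ∈ concat T) where

  -- The presence of both letters rules out the vacuous cases.
  ¬Weak×Strict : Weak T k → ¬ Strict T k
  ¬Weak×Strict weak strict =
    let (_ , p) = ∈⇒InRow T k∈T
        (_ , q) = ∈⇒InRow T sk∈T
    in <⇒≱ (strict p q) (weak p q)

  descent-same : ∀ {u′ v′} → u′ ≢ v′ → Descents T k u v → Descents T k u′ v′ → v < u → v′ < u′
  descent-same u′≢v′ (_ , strict) (weak , _) v<u =
    <-from-≯ (u′≢v′ ∘ sym) (λ u′<v′ → ¬Weak×Strict (weak u′<v′) (strict v<u))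

  module _ {u′ v′} (std : Standard T) (D : Descents T k u v)
           (Dᵗ : Descents (transpose T) k u′ v′) where

    -- In both directions the wrong order would make `suc k` lie strictly below `k`, or weakly above
    -- it, in `T` and in its transpose at once.
    descent-transpose⁺ : u′ ≢ v′ → v < u → u′ < v′
    descent-transpose⁺ u′≢v′ v<u = <-from-≯ u′≢v′ λ v′<u′ →
      Strict-transpose (proj₁ std) (proj₂ std) k∈T sk∈T (proj₂ D v<u) (proj₂ Dᵗ v′<u′)

    descent-transpose⁻ : u ≢ v → u′ < v′ → v < u
    descent-transpose⁻ u≢v u′<v′ = <-from-≯ (u≢v ∘ sym) λ u<v →
      Weak-transpose (proj₁ std) (proj₂ std) k∈T sk∈T (proj₁ D u<v) (proj₁ Dᵗ u′<v′)

-- Signed permutations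

-- The tableaux Q_ε belonging to g stand in this relation to g, and the tableaux
-- P_ε to the inverse of g.
record Describes {n} (s : Sign) (g : SignedPermutation n) (T : Tableau) : Set where
  field
    standard : Standard T
    ∈⁺       : ∀ i → sign g i ≡ s → suc (toℕ i) ∈ concat T
    ∈⁻       : ∀ i → suc (toℕ i) ∈ concat T → sign g i ≡ s
    descents : ∀ i j → toℕ j ≡ suc (toℕ i) → sign g i ≡ s → sign g j ≡ s →
               Descents T (suc (toℕ i)) (∣ g ∣at i) (∣ g ∣at j)

open Describes

module _ {n : ℕ} (g : SignedPermutation n) where

  ∣∣-injective : ∀ {i j} → ∣ g ∣at i ≡ ∣ g ∣at j → i ≡ j
  ∣∣-injective eq =
    trans (sym (Perm.inverseˡ (perm g)))
      (trans (cong (perm g ⟨$⟩ˡ_) (toℕ-injective (suc-injective eq))) (Perm.inverseˡ (perm g)))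

  ∣∣-≢ : ∀ {i j} → toℕ j ≡ suc (toℕ i) → ∣ g ∣at i ≢ ∣ g ∣at j
  ∣∣-≢ j≡1+i eq = 1+n≢n (sym (trans (cong toℕ (∣∣-injective eq)) j≡1+i))

reverse-AllPairs : ∀ {R : Rel A 0ℓ} {xs} → AllPairs R xs → AllPairs (flip R) (reverse xs)
reverse-AllPairs []                     = []
reverse-AllPairs {R = R} {x ∷ xs} (x~xs ∷ p) =
  subst (AllPairs (flip R)) (sym (unfold-reverse x xs))
    (AllPairs.++⁺ (reverse-AllPairs p) ([] ∷ [])
      (All.map (_∷ []) (All-resp-↭ (↭-sym (↭-reverse xs)) x~xs)))

module _ {n : ℕ} (s : Sign) (g : SignedPermutation n) where

  private
    word : List (ℕ × ℕ)
    word = reverse (subword s g)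

    run : Run word (proj₁ (schensted (subword s g))) (proj₂ (schensted (subword s g)))
    run = schensted-run (subword s g)

    sign? : ∀ i → Dec (sign g i ≡ s)
    sign? i = sign g i Sign.≟ s

    valid : AllPairs Later word
    valid = reverse-AllPairs (AllPairs.map⁺ (AllPairs.filter⁺ sign? (AllPairs.tabulate⁺-<
      λ i<j → s≤s i<j , λ eq → <⇒≢ i<j (cong toℕ (sym (∣∣-injective g eq))))))

    ∈-word⁺ : ∀ i → sign g i ≡ s → (suc (toℕ i) , ∣ g ∣at i) ∈ word
    ∈-word⁺ i eq = reverse⁺ (∈-map⁺ _ (∈-filter⁺ sign? (∈-allFin i) eq))

    ∈-word⁻ : ∀ {p} → p ∈ word → ∃ λ i → p ≡ (suc (toℕ i) , ∣ g ∣at i) × sign g i ≡ s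
    ∈-word⁻ p∈ =
      let (i , i∈ , eq) = ∈-map⁻ _ (reverse⁻ p∈)
      in i , eq , proj₂ (∈-filter⁻ sign? {xs = allFin n} i∈)

    ∈-word-inverse : ∀ j → sign (inverseˢ g) j ≡ s → (∣ inverseˢ g ∣at j , suc (toℕ j)) ∈ word
    ∈-word-inverse j eq =
      subst (λ l → (∣ inverseˢ g ∣at j , suc (toℕ l)) ∈ word) (Perm.inverseʳ (perm g))
        (∈-word⁺ (perm g ⟨$⟩ˡ j) eq)

  recording-describes : Describes s g (proj₂ (schensted (subword s g)))
  recording-describes = record
    { standard = recording-Rows valid run , recording-Columns valid run
    ; ∈⁺       = λ i eq → ∈-resp-↭ (↭-sym (run-labels run)) (∈-map⁺ proj₁ (∈-word⁺ i eq))
    ; ∈⁻       = λ i i∈ →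
        let (_ , p∈ , eq)  = ∈-map⁻ proj₁ (∈-resp-↭ (run-labels run) i∈)
            (j , eq′ , eq″) = ∈-word⁻ p∈
            i≡j = toℕ-injective (suc-injective (trans eq (cong proj₁ eq′)))
        in trans (cong (sign g) i≡j) eq″
    ; descents = λ i j j≡1+i eqᵢ eqⱼ → recording-descents valid run (∈-word⁺ i eqᵢ)
        (subst (λ k → (suc k , ∣ g ∣at j) ∈ word) j≡1+i (∈-word⁺ j eqⱼ))
    }

  -- The value `j` carries the label that the inverse of `g` takes as absolute value at `j`, and the
  -- sign of the inverse at `j` is that of `g` at this label. So exchanging labels and values in the
  -- word passes to the inverse.
  insertion-describes : Describes s (inverseˢ g) (proj₁ (schensted (subword s g)))
  insertion-describes = record
    { standard = run-Rows valid run , run-Columns run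
    ; ∈⁺       = λ j eq → ∈-resp-↭ (↭-sym (run-values run)) (∈-map⁺ proj₂ (∈-word-inverse j eq))
    ; ∈⁻       = λ j j∈ →
        let (_ , p∈ , eq)  = ∈-map⁻ proj₂ (∈-resp-↭ (run-values run) j∈)
            (i , eq′ , eq″) = ∈-word⁻ p∈
            j≡gi = toℕ-injective (suc-injective (trans eq (cong proj₂ eq′)))
        in trans (cong (sign g) (trans (cong (perm g ⟨$⟩ˡ_) j≡gi) (Perm.inverseˡ (perm g)))) eq″
    ; descents = λ i j j≡1+i eqᵢ eqⱼ → insertion-descents valid run (∈-word-inverse i eqᵢ)
        (subst (λ k → (∣ inverseˢ g ∣at j , suc k) ∈ word) j≡1+i (∈-word-inverse j eqⱼ))
    }

-- Comparison of the two orders and of the two descent sets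

-- The two orders agree on non-negative numbers and on mixed signs, and are opposite on negative
-- numbers; hence the reversed inequality in the second premise. Absolute values are written as
-- successors so that `◃` reduces to constructors.
◃-descent : ∀ s t {a b a′ b′} →
            (s ≡ Sign.+ → t ≡ Sign.+ →
              (suc b < suc a → suc b′ < suc a′) × (suc b′ < suc a′ → suc b < suc a)) →
            (s ≡ Sign.- → t ≡ Sign.- →
              (suc b < suc a → suc a′ < suc b′) × (suc a′ < suc b′ → suc b < suc a)) →
            (t ◃ suc b <ᶜ s ◃ suc a → t ◃ suc b′ ℤ.< s ◃ suc a′) ×
            (t ◃ suc b′ ℤ.< s ◃ suc a′ → t ◃ suc b <ᶜ s ◃ suc a)
◃-descent Sign.+ Sign.+ pos neg =
  (λ { (+<+ p) → ℤ.+<+ (proj₁ (pos refl refl) p) }) ,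
  (λ { (ℤ.+<+ p) → +<+ (proj₂ (pos refl refl) p) })
◃-descent Sign.+ Sign.- pos neg = (λ _ → ℤ.-<+) , (λ _ → -<+)
◃-descent Sign.- Sign.+ pos neg = (λ ()) , (λ ())
◃-descent Sign.- Sign.- pos neg =
  (λ { (-<- p) → ℤ.-<- (s<s⁻¹ (proj₁ (neg refl refl) (s≤s p))) }) ,
  (λ { (ℤ.-<- p) → -<- (s<s⁻¹ (proj₂ (neg refl refl) (s≤s p))) })

-- In both orders exactly the negative numbers precede 0, so a descent at 0 depends on the sign
-- alone.
◃-negative : ∀ s {a a′} → (s ◃ suc a <ᶜ ℤ.+0 → s ◃ suc a′ ℤ.< ℤ.+0) ×
                          (s ◃ suc a′ ℤ.< ℤ.+0 → s ◃ suc a <ᶜ ℤ.+0)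
◃-negative Sign.+ = (λ { (+<+ ()) }) , (λ { (ℤ.+<+ ()) })
◃-negative Sign.- = (λ _ → ℤ.-<+) , (λ _ → -<+)

module _ {n : ℕ} {g h : SignedPermutation n} {T₀ T₁ : Tableau}
         (g₀ : Describes Sign.+ g T₀) (g₁ : Describes Sign.- g T₁)
         (h₀ : Describes Sign.+ h T₀) (h₁ : Describes Sign.- h (transpose T₁)) where

  -- The sign at a place is determined by which of the two tableaux contains it, and transposition
  -- keeps the entries.
  sign-≡ : ∀ i → sign g i ≡ sign h i
  sign-≡ i with sign g i in eq
  ... | Sign.+ = sym (∈⁻ h₀ i (∈⁺ g₀ i eq))
  ... | Sign.- = sym (∈⁻ h₁ i (∈-transpose⁺ T₁ (∈⁺ g₁ i eq)))

  Neg-≐ : Neg g ≐ Neg h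
  Neg-≐ = (λ {i} → trans (sym (sign-≡ i))) , (λ {i} → trans (sign-≡ i))

  descent-at : ∀ i j → toℕ j ≡ suc (toℕ i) →
               (g at Fin.suc j <ᶜ g at Fin.suc i → h at Fin.suc j ℤ.< h at Fin.suc i) ×
               (h at Fin.suc j ℤ.< h at Fin.suc i → g at Fin.suc j <ᶜ g at Fin.suc i)
  descent-at i j j≡1+i =
    -- The signs of `h` are exchanged for the equal signs of `g`, so that `◃-descent` can split on
    -- one pair of signs.
    subst₂ (λ s t → (g at Fin.suc j <ᶜ g at Fin.suc i → t ◃ ∣ h ∣at j ℤ.< s ◃ ∣ h ∣at i) ×
                    (t ◃ ∣ h ∣at j ℤ.< s ◃ ∣ h ∣at i → g at Fin.suc j <ᶜ g at Fin.suc i))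
           (sign-≡ i) (sign-≡ j)
           (◃-descent (sign g i) (sign g j) positive negative)
    where
    next∈ : ∀ {s f T} → Describes s f T → sign f j ≡ s → suc (suc (toℕ i)) ∈ concat T
    next∈ {T = T} d eq = subst (λ k → suc k ∈ concat T) j≡1+i (∈⁺ d j eq)

    positive : sign g i ≡ Sign.+ → sign g j ≡ Sign.+ →
               (∣ g ∣at j < ∣ g ∣at i → ∣ h ∣at j < ∣ h ∣at i) ×
               (∣ h ∣at j < ∣ h ∣at i → ∣ g ∣at j < ∣ g ∣at i)
    positive eqᵢ eqⱼ =
      let i∈ = ∈⁺ g₀ i eqᵢ
          j∈ = next∈ g₀ eqⱼ
          D  = descents g₀ i j j≡1+i eqᵢ eqⱼ
          D′ = descents h₀ i j j≡1+i (trans (sym (sign-≡ i)) eqᵢ) (trans (sym (sign-≡ j)) eqⱼ)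
      in descent-same i∈ j∈ (∣∣-≢ h j≡1+i) D D′ , descent-same i∈ j∈ (∣∣-≢ g j≡1+i) D′ D

    negative : sign g i ≡ Sign.- → sign g j ≡ Sign.- →
               (∣ g ∣at j < ∣ g ∣at i → ∣ h ∣at i < ∣ h ∣at j) ×
               (∣ h ∣at i < ∣ h ∣at j → ∣ g ∣at j < ∣ g ∣at i)
    negative eqᵢ eqⱼ =
      let i∈ = ∈⁺ g₁ i eqᵢ
          j∈ = next∈ g₁ eqⱼ
          D  = descents g₁ i j j≡1+i eqᵢ eqⱼ
          Dᵗ = descents h₁ i j j≡1+i (trans (sym (sign-≡ i)) eqᵢ) (trans (sym (sign-≡ j)) eqⱼ)
      in descent-transpose⁺ i∈ j∈ (standard g₁) D Dᵗ (∣∣-≢ h j≡1+i)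
       , descent-transpose⁻ i∈ j∈ (standard g₁) D Dᵗ (∣∣-≢ g j≡1+i)

  descent : ∀ i → (Des g i → Des′ h i) × (Des′ h i → Des g i)
  descent Fin.zero =
    subst (λ s → (Des g Fin.zero → s ◃ ∣ h ∣at Fin.zero ℤ.< ℤ.+0) ×
                 (s ◃ ∣ h ∣at Fin.zero ℤ.< ℤ.+0 → Des g Fin.zero))
          (sign-≡ Fin.zero) (◃-negative (sign g Fin.zero))
  descent (Fin.suc i) = descent-at (inject₁ i) (Fin.suc i) (cong suc (sym (toℕ-inject₁ i)))

  Des-≐ : Des g ≐ Des′ h
  Des-≐ = (λ {i} → proj₁ (descent i)) , (λ {i} → proj₂ (descent i))

proposition7p2 : ∀ (n : ℕ) .{{_ : NonZero n}} → let open Group (B n) in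
    ∀ (φ : Carrier → Carrier) →
    (∀ g → robinsonSchensted (φ g) ≡ transposeSecond (robinsonSchensted g)) →
    ∀ g → (Neg g ≐ Neg (φ g))
    × (Des g ≐ Des′ (φ g))
    × (Des (g ⁻¹) ≐ Des′ ((φ g) ⁻¹))
proposition7p2 n φ rs-φ g =
    Neg-≐ (recording-describes _ g) (recording-describes _ g) q₀ q₁
  , Des-≐ (recording-describes _ g) (recording-describes _ g) q₀ q₁
  -- Part (c) is the argument of (b) for the inverses, with the insertion tableaux in place of the
  -- recording tableaux.
  , Des-≐ (insertion-describes _ g) (insertion-describes _ g) p₀ p₁
  where
  -- The equation defining `φ` is projected to each of the four tableaux: those of `φ g` are those
  -- of `g`, transposed for the negative sign.
  p₀ = subst (Describes Sign.+ (inverseˢ (φ g)))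
             (cong (proj₁ ∘ proj₁) (rs-φ g)) (insertion-describes Sign.+ (φ g))
  p₁ = subst (Describes Sign.- (inverseˢ (φ g)))
             (cong (proj₂ ∘ proj₁) (rs-φ g)) (insertion-describes Sign.- (φ g))
  q₀ = subst (Describes Sign.+ (φ g))
             (cong (proj₁ ∘ proj₂) (rs-φ g)) (recording-describes Sign.+ (φ g))
  q₁ = subst (Describes Sign.- (φ g))
             (cong (proj₂ ∘ proj₂) (rs-φ g)) (recording-describes Sign.- (φ g))
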